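{- The notion of a Ramsey algebra is not necessarily preserved under elementary equivalence: there exist infinite algebras $\mathcal{A}$ and $\mathcal{B}$ of the same language such that $\mathcal{A}\equiv\mathcal{B}$ (elementarily equivalent), $\mathcal{A}$ is a Ramsey algebra, and $\mathcal{B}$ is not a Ramsey algebra.
   Context: An algebra $\mathcal{A}=(A,\mathcal{F})$ consists of a set $A$ and a family $\mathcal{F}$ of finitary operations $f:A^n\to A$ on $A$; it is infinite if $A$ is infinite. When $\mathcal{L}$ is a set of function symbols (a purely functional language), an algebra of the language $\mathcal{L}$ is an $\mathcal{L}$-structure, $\mathcal{F}$ being the family of interpretations of the symbols; elementary equivalence is in the sense of first-order logic. An $n$-ary $f$ is an orderly composition of a family $\mathcal{G}$ of operations if there are a $k$-ary $g\in\mathcal{G}$ and $n_j$-ary $h_j\in\mathcal{G}$ ($1\le j\le k$) with $\sum_{j=1}^k n_j=n$ such that $f(x_1,\dots,x_n)=g(h_1(\bar x_1),\dots,h_k(\bar x_k))$, where $\bar x_1,\dots,\bar x_k$ are the consecutive blocks of $(x_1,\dots,x_n)$ of lengths $n_1,\dots,n_k$. The set $\mathrm{OT}(\mathcal{F})$ of orderly terms over $\mathcal{F}$ is the smallest collection of operations on $A$ that contains $\mathcal{F}\cup\{\mathrm{id}_A\}$ and is closed under orderly composition. For infinite sequences $\vec a,\vec b\in{}^\omega A$, $\vec a$ is a reduction of $\vec b$, written $\vec a\le_{\mathcal{F}}\vec b$, if there are orderly terms $f_j\in\mathrm{OT}(\mathcal{F})$ and finite subsequences $\vec b_j$ of $\vec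 b$ ($j\in\omega$) such that $\vec a(j)=f_j(\vec b_j)$ for every $j$ and the concatenation $\vec b_0*\vec b_1*\cdots$ is a subsequence of $\vec b$. Put $\mathrm{FR}_{\mathcal{F}}(\vec b)=\{\vec a(0):\vec a\le_{\mathcal{F}}\vec b\}$. The algebra $(A,\mathcal{F})$ is a Ramsey algebra if for every $\vec b\in{}^\omega A$ and every $X\subseteq A$ there is $\vec a\le_{\mathcal{F}}\vec b$ such that $\mathrm{FR}_{\mathcal{F}}(\vec a)$ is either contained in $X$ or disjoint from $X$. -}

module Defs where

open import Data.Empty using (⊥)
open import Data.Fin.Base as Fin using (Fin; zero; suc)
open import Data.Nat.Base as ℕ using (ℕ; zero; suc)
open import Data.Product.Base using (Σ; Σ-syntax; ∃-syntax; _×_; _,_; proj₁; proj₂)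
open import Data.Sum.Base using (_⊎_)
open import Data.Vec.Base using (Vec; []; _∷_; head; lookup; sum; take; drop; tabulate)
open import Function.Base using (_∘_)
open import Function.Bundles using (_⇔_; _↔_)
open import Level using (0ℓ)
open import Relation.Binary.Core using (Rel)
open import Relation.Binary.PropositionalEquality.Core using (_≡_)
open import Relation.Nullary.Negation.Core using (¬_)
open import Relation.Unary using (Pred; _⊆_) renaming (_⊥_ to _isDisjointFrom_)

Op : Set → ℕ → Set
Op A n = Vec A n → A

Infinite : Set → Set
Infinite A = ¬ (∃[ n ] (A ↔ Fin n))

record Language : Set₁ where
  field
    Symbol : Set
    arity  : Symbol → ℕ

open Language public

record Algebra (L : Language) : Set₁ where
  field
    Carrier : Set
    op      : (s : Symbol L) → Op Carrier (arity L s)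

open Algebra public

------------------------------------------------------------------------
-- First-order logic with equality over a purely functional language.
-- Variables are de Bruijn indices; a formula in Formula L n has its free
-- variables among n, and negation is φ ⇒ false.

data Term (L : Language) (n : ℕ) : Set where
  var : Fin n → Term L n
  app : (s : Symbol L) → (Fin (arity L s) → Term L n) → Term L n

data Formula (L : Language) : ℕ → Set where
  _≐_         : ∀ {n} → Term L n → Term L n → Formula L n
  false       : ∀ {n} → Formula L n
  _∧_ _∨_ _⇒_ : ∀ {n} → Formula L n → Formula L n → Formula L n
  all ex      : ∀ {n} → Formula L (suc n) → Formula L n

Sentence : Language → Set
Sentence L = Formula L 0

⟦_⟧ : ∀ {L n} → Term L n → (𝒜 : Algebra L) → Vec (Carrier 𝒜) n → Carrier 𝒜
⟦ var i ⟧    𝒜 ρ = lookup ρ i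
⟦ app s ts ⟧ 𝒜 ρ = op 𝒜 s (tabulate (λ i → ⟦ ts i ⟧ 𝒜 ρ))

Satisfies : ∀ {L n} (𝒜 : Algebra L) → Vec (Carrier 𝒜) n → Formula L n → Set
Satisfies 𝒜 ρ (t ≐ u) = ⟦ t ⟧ 𝒜 ρ ≡ ⟦ u ⟧ 𝒜 ρ
Satisfies 𝒜 ρ false   = ⊥
Satisfies 𝒜 ρ (φ ∧ ψ) = Satisfies 𝒜 ρ φ × Satisfies 𝒜 ρ ψ
Satisfies 𝒜 ρ (φ ∨ ψ) = Satisfies 𝒜 ρ φ ⊎ Satisfies 𝒜 ρ ψ
Satisfies 𝒜 ρ (φ ⇒ ψ) = Satisfies 𝒜 ρ φ → Satisfies 𝒜 ρ ψ
Satisfies 𝒜 ρ (all φ) = ∀ x → Satisfies 𝒜 (x ∷ ρ) φ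
Satisfies 𝒜 ρ (ex φ)  = ∃[ x ] Satisfies 𝒜 (x ∷ ρ) φ

_⊨_ : ∀ {L} → Algebra L → Sentence L → Set
𝒜 ⊨ φ = Satisfies 𝒜 [] φ

ElementarilyEquivalent : ∀ {L} → Algebra L → Algebra L → Set
ElementarilyEquivalent {L} 𝒜 ℬ = (φ : Sentence L) → (𝒜 ⊨ φ) ⇔ (ℬ ⊨ φ)

------------------------------------------------------------------------
-- Orderly terms

applyBlocks : ∀ {A k} (ns : Vec ℕ k) → ((j : Fin k) → Op A (lookup ns j)) →
              Vec A (sum ns) → Vec A k
applyBlocks []       hs xs = []
applyBlocks (n ∷ ns) hs xs =
  hs zero (take n xs) ∷ applyBlocks ns (hs ∘ suc) (drop n xs)

-- Operations are identified when they agree pointwise, since function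
-- extensionality is not available: f is only required to agree with the
-- composite at every argument.
data OrderlyComposition {A : Set} (𝒢 : ∀ {n} → Op A n → Set) :
                        ∀ {n} → Op A n → Set where
  compose : ∀ {k} {g : Op A k} (ns : Vec ℕ k)
            {hs : (j : Fin k) → Op A (lookup ns j)} {f : Op A (sum ns)} →
            𝒢 g → ((j : Fin k) → 𝒢 (hs j)) →
            (∀ xs → f xs ≡ g (applyBlocks ns hs xs)) →
            OrderlyComposition 𝒢 f

data OrderlyTerm {L : Language} (𝒜 : Algebra L) :
                 ∀ {n} → Op (Carrier 𝒜) n → Set where
  basic    : (s : Symbol L) → OrderlyTerm 𝒜 (op 𝒜 s)
  identity : OrderlyTerm 𝒜 {1} head
  closed   : ∀ {n} {f : Op (Carrier 𝒜) n} →
             OrderlyComposition (OrderlyTerm 𝒜) f → OrderlyTerm 𝒜 f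

------------------------------------------------------------------------
-- Sequences and reductions

Sequence : Set → Set
Sequence A = ℕ → A

-- The candidate subsequence may be indexed by any ordered set of
-- positions, so that finite sequences and concatenations are covered too.
IsSubsequence : {A I : Set} → Rel I 0ℓ → (I → A) → Sequence A → Set
IsSubsequence {I = I} _≺_ c b =
  Σ[ ι ∈ (I → ℕ) ] (∀ {p q} → p ≺ q → ι p ℕ.< ι q) × (∀ p → c p ≡ b (ι p))

IsFiniteSubsequence : {A : Set} {n : ℕ} → Vec A n → Sequence A → Set
IsFiniteSubsequence v b = IsSubsequence Fin._<_ (lookup v) b

-- The concatenation of v 0, v 1, … , where v j has length ℓ j: its
-- positions are the pairs (j , i) with i < ℓ j, ordered lexicographically.
Position : (ℕ → ℕ) → Set
Position ℓ = Σ[ j ∈ ℕ ] Fin (ℓ j)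

data _<ₗₑₓ_ {ℓ : ℕ → ℕ} : Position ℓ → Position ℓ → Set where
  across : ∀ {j k p q} → j ℕ.< k → (j , p) <ₗₑₓ (k , q)
  within : ∀ {j p q} → p Fin.< q → (j , p) <ₗₑₓ (j , q)

concatenation : {A : Set} {ℓ : ℕ → ℕ} → ((j : ℕ) → Vec A (ℓ j)) → Position ℓ → A
concatenation v (j , i) = lookup (v j) i

record Reduction {L : Language} (𝒜 : Algebra L)
                 (a b : Sequence (Carrier 𝒜)) : Set where
  field
    len           : ℕ → ℕ
    term          : (j : ℕ) → Op (Carrier 𝒜) (len j)
    term-orderly  : (j : ℕ) → OrderlyTerm 𝒜 (term j)
    block         : (j : ℕ) → Vec (Carrier 𝒜) (len j)
    block-sub     : (j : ℕ) → IsFiniteSubsequence (block j) b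
    a≡term        : (j : ℕ) → a j ≡ term j (block j)
    concat-sub    : IsSubsequence _<ₗₑₓ_ (concatenation block) b

FR : ∀ {L} (𝒜 : Algebra L) → Sequence (Carrier 𝒜) → Pred (Carrier 𝒜) 0ℓ
FR 𝒜 b x = ∃[ a ] (Reduction 𝒜 a b × a 0 ≡ x)

-- Deciding which alternative holds is classical: for an inhabited carrier,
-- taking X constantly equal to a proposition P makes IsRamsey 𝒜 decide P.
IsRamsey : ∀ {L} → Algebra L → Set₁
IsRamsey 𝒜 =
  (b : Sequence (Carrier 𝒜)) (X : Pred (Carrier 𝒜) 0ℓ) →
  ∃[ a ] (Reduction 𝒜 a b × (FR 𝒜 a ⊆ X ⊎ FR 𝒜 a isDisjointFrom X))

{-# OPTIONS --safe #-}
module Submission where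

-- Every natural number i is a unary symbol.  In flipAlgebra flips a sink is fixed
-- by all operations, and on the pair {k} × Bool the operation i either flips the
-- Boolean, when flips i k holds, or jumps to the sink.  If k ranges over ℕ and i
-- flips exactly the pairs k > i, every element is sent to the sink by some
-- operation, so every sequence reduces to the constant sequence at the sink and
-- the algebra is Ramsey.  Adding one pair that all operations flip destroys this:
-- no reduction of a constant sequence in the extra pair is homogeneous for one
-- half of the pair.  The first n operations cannot tell the extra pair from the
-- pairs k ≥ n, so the reducts of both algebras to any finite set of symbols are
-- isomorphic, which gives elementary equivalence.

open import Defs
open import Axiom.ExcludedMiddle using (ExcludedMiddle)
open import Data.Bool.Base using (Bool; true; false; not; if_then_else_)
open import Data.Fin.Base using (Fin; zero; suc)
open import Data.Fin.Properties using (ℕ→Fin-notInjective)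
open import Data.Maybe.Base as Maybe using (Maybe; just; nothing)
open import Data.Maybe.Properties using (just-injective)
open import Data.Nat.Base using (ℕ; zero; suc; _≤_; _<_; _<ᵇ_; _⊔_; s≤s)
open import Data.Nat.Properties using (≤-refl; ≤-trans; m≤m⊔n; m≤n⊔m)
open import Data.Product.Base using (Σ-syntax; ∃-syntax; _×_; _,_; proj₁; proj₂)
open import Data.Product.Function.NonDependent.Propositional using (_×-⇔_; _×-↔_)
open import Data.Sum.Base using (_⊎_; inj₁; inj₂)
open import Data.Sum.Function.Propositional using (_⊎-⇔_; _⊎-↔_)
open import Data.Sum.Properties using (inj₂-injective)
open import Data.Unit.Base using (⊤; tt)
open import Data.Vec.Base using (Vec; []; _∷_; head; lookup; map)
open import Data.Vec.Properties using (lookup-map; tabulate-∘; tabulate-cong)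
open import Data.Vec.Relation.Unary.All using (All; []; _∷_)
open import Data.Vec.Relation.Unary.All.Properties using (take⁺; drop⁺; lookup⁻)
open import Function.Base using (_∘_; id)
open import Function.Bundles
  using (_⇔_; mk⇔; _↔_; mk↔ₛ′; module Equivalence; module Inverse; module Injection)
open import Function.Definitions using (Injective)
open import Function.Properties.Inverse using (↔-refl; ↔⇒↣)
open import Function.Related.TypeIsomorphisms using (→-cong-⇔)
open import Level using (0ℓ)
open import Relation.Binary.PropositionalEquality
  using (_≡_; refl; sym; trans; cong; subst)
open import Relation.Nullary.Decidable.Core using (yes; no)
open import Relation.Nullary.Negation.Core using (¬_)
open import Relation.Unary using (Pred; _⊆_) renaming (_⊥_ to _isDisjointFrom_)

open Inverse using (to; from; strictlyInverseˡ)

-- Properties of all sufficiently large numbers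

Eventually : Pred ℕ 0ℓ → Set
Eventually P = ∃[ N ] (∀ n → N ≤ n → P n)

eventually-map₂ : ∀ {P Q R : Pred ℕ 0ℓ} → (∀ {n} → P n → Q n → R n) →
                  Eventually P → Eventually Q → Eventually R
eventually-map₂ f (M , p) (N , q) = M ⊔ N , λ n M⊔N≤n →
  f (p n (≤-trans (m≤m⊔n M N) M⊔N≤n)) (q n (≤-trans (m≤n⊔m M N) M⊔N≤n))

eventually-map : ∀ {P Q : Pred ℕ 0ℓ} → (∀ {n} → P n → Q n) → Eventually P → Eventually Q
eventually-map f (N , p) = N , λ n N≤n → f (p n N≤n)

eventually-Fin : ∀ {m} {P : Fin m → Pred ℕ 0ℓ} → (∀ i → Eventually (P i)) →
                 Eventually (λ n → ∀ i → P i n)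
eventually-Fin {zero}  ps = 0 , λ _ _ ()
eventually-Fin {suc m} ps =
  eventually-map₂ (λ p q → λ { zero → p ; (suc i) → q i })
    (ps zero) (eventually-Fin (ps ∘ suc))

-- Elementary equivalence from bijections that eventually respect each symbol

module _ {L : Language} (𝒜 ℬ : Algebra L) (h : ℕ → Carrier 𝒜 ↔ Carrier ℬ)
         (h-op : ∀ s → Eventually λ n → ∀ xs →
                 to (h n) (op 𝒜 s xs) ≡ op ℬ s (map (to (h n)) xs)) where

  private
    PreservesTerm : ∀ {m} → Term L m → Pred ℕ 0ℓ
    PreservesTerm t n = ∀ ρ → to (h n) (⟦ t ⟧ 𝒜 ρ) ≡ ⟦ t ⟧ ℬ (map (to (h n)) ρ)

    PreservesFormula : ∀ {m} → Formula L m → Pred ℕ 0ℓ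
    PreservesFormula φ n = ∀ ρ → Satisfies 𝒜 ρ φ ⇔ Satisfies ℬ (map (to (h n)) ρ) φ

  -- Only finitely many symbols occur in a term, so the maximum of their thresholds serves the whole
  -- term.
  eventually-term : ∀ {m} (t : Term L m) → Eventually (PreservesTerm t)
  eventually-term (var i)    = 0 , λ n _ ρ → sym (lookup-map i (to (h n)) ρ)
  eventually-term (app s ts) =
    eventually-map₂ step (h-op s) (eventually-Fin (eventually-term ∘ ts))
    where
    step : ∀ {n} → (∀ xs → to (h n) (op 𝒜 s xs) ≡ op ℬ s (map (to (h n)) xs)) →
           (∀ i → PreservesTerm (ts i) n) → PreservesTerm (app s ts) n
    step {n} h-s h-ts ρ = trans (h-s _) (cong (op ℬ s)
      (trans (sym (tabulate-∘ (to (h n)) _)) (tabulate-cong λ i → h-ts i ρ)))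

  -- Induction on the formula. The threshold does not depend on `ρ`, so a quantifier keeps the
  -- threshold of its body; bijectivity of `h n` then moves witnesses and instances between the
  -- carriers.
  eventually-formula : ∀ {m} (φ : Formula L m) → Eventually (PreservesFormula φ)
  eventually-formula (t ≐ u) =
    eventually-map₂ step (eventually-term t) (eventually-term u)
    where
    step : ∀ {n} → PreservesTerm t n → PreservesTerm u n → PreservesFormula (t ≐ u) n
    step {n} h-t h-u ρ = mk⇔
      (λ eq → trans (sym (h-t ρ)) (trans (cong (to (h n)) eq) (h-u ρ)))
      -- Injectivity of `h n` reflects equality back to `𝒜`.
      (λ eq → Injection.injective (↔⇒↣ (h n)) (trans (h-t ρ) (trans eq (sym (h-u ρ)))))
  eventually-formula false = 0 , λ _ _ _ → mk⇔ id id
  eventually-formula (φ ∧ ψ) =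
    eventually-map₂ (λ p q ρ → p ρ ×-⇔ q ρ) (eventually-formula φ) (eventually-formula ψ)
  eventually-formula (φ ∨ ψ) =
    eventually-map₂ (λ p q ρ → p ρ ⊎-⇔ q ρ) (eventually-formula φ) (eventually-formula ψ)
  eventually-formula (φ ⇒ ψ) =
    eventually-map₂ (λ p q ρ → →-cong-⇔ (p ρ) (q ρ)) (eventually-formula φ) (eventually-formula ψ)
  eventually-formula (all φ) = eventually-map step (eventually-formula φ)
    where
    step : ∀ {n} → PreservesFormula φ n → PreservesFormula (all φ) n
    step {n} p ρ = mk⇔
      (λ sat y → subst (λ y → Satisfies ℬ (y ∷ _) φ) (strictlyInverseˡ (h n) y)
        (Equivalence.to (p (from (h n) y ∷ ρ)) (sat (from (h n) y))))
      (λ sat x → Equivalence.from (p (x ∷ ρ)) (sat (to (h n) x)))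
  eventually-formula (ex φ) = eventually-map step (eventually-formula φ)
    where
    step : ∀ {n} → PreservesFormula φ n → PreservesFormula (ex φ) n
    step {n} p ρ = mk⇔
      (λ (x , sat) → to (h n) x , Equivalence.to (p (x ∷ ρ)) sat)
      (λ (y , sat) → from (h n) y , Equivalence.from (p (from (h n) y ∷ ρ))
        (subst (λ y → Satisfies ℬ (y ∷ _) φ) (sym (strictlyInverseˡ (h n) y)) sat))

  eventuallyIsomorphic⇒elementarilyEquivalent : ElementarilyEquivalent 𝒜 ℬ
  eventuallyIsomorphic⇒elementarilyEquivalent φ = let N , p = eventually-formula φ in p N ≤-refl []

-- Orderly terms, subalgebras and reductions

module _ {L : Language} (𝒜 : Algebra L) where

  module _ {P : Pred (Carrier 𝒜) 0ℓ}
           (op-closed : ∀ s {xs} → All P xs → P (op 𝒜 s xs)) where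

    applyBlocks-closed : ∀ {k} (ns : Vec ℕ k) {hs : (j : Fin k) → Op (Carrier 𝒜) (lookup ns j)} →
                         (∀ j {xs} → All P xs → P (hs j xs)) →
                         ∀ {xs} → All P xs → All P (applyBlocks ns hs xs)
    applyBlocks-closed []       hs ps = []
    applyBlocks-closed (n ∷ ns) hs ps =
      hs zero (take⁺ n ps) ∷ applyBlocks-closed ns (hs ∘ suc) (drop⁺ n ps)

    orderlyTerm-closed : ∀ {n} {f : Op (Carrier 𝒜) n} → OrderlyTerm 𝒜 f →
                         ∀ {xs} → All P xs → P (f xs)
    orderlyTerm-closed (basic s)  ps       = op-closed s ps
    orderlyTerm-closed identity   (p ∷ []) = p
    orderlyTerm-closed (closed (compose ns g hs f≗)) {xs} ps =
      subst P (sym (f≗ xs)) (orderlyTerm-closed g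
        (applyBlocks-closed ns (λ j → orderlyTerm-closed (hs j)) ps))

    -- Orderly terms preserve every subalgebra `P`, and all block entries are entries of `b`. This
    -- bounds `FR` from above, with `P` the sink in one algebra and the extra pair in the other.
    reduction-closed : ∀ {a b} → Reduction 𝒜 a b → (∀ j → P (b j)) → ∀ j → P (a j)
    reduction-closed r b∈P j =
      subst P (sym (a≡term j)) (orderlyTerm-closed (term-orderly j) (lookup⁻ λ i →
        subst P (sym (proj₂ (proj₂ (block-sub j)) i)) (b∈P _)))
      where open Reduction r

  -- The `j`-th block consists of `b j` alone, so the blocks concatenate to `b` itself.
  termwise : ∀ {a b} (f : ℕ → Op (Carrier 𝒜) 1) → (∀ j → OrderlyTerm 𝒜 (f j)) →
             (∀ j → a j ≡ f j (b j ∷ [])) → Reduction 𝒜 a b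
  termwise {a} {b} f f-orderly a≡f = record
    { len          = λ _ → 1
    ; term         = f
    ; term-orderly = f-orderly
    ; block        = λ j → b j ∷ []
    ; block-sub    = λ j → (λ _ → j) , (λ { {zero} {zero} () }) , λ { zero → refl }
    ; a≡term       = a≡f
    ; concat-sub   = proj₁ , increasing , λ { (j , zero) → refl }
    }
    where
    increasing : ∀ {p q : Position (λ _ → 1)} → p <ₗₑₓ q → proj₁ p < proj₁ q
    increasing (across j<k) = j<k
    increasing (within {p = zero} {q = zero} ())

infinite : ∀ {A : Set} {f : ℕ → A} → Injective _≡_ _≡_ f → Infinite A
infinite {f = f} f-injective (n , A↔Fin) =
  ℕ→Fin-notInjective (to A↔Fin ∘ f) (f-injective ∘ Injection.injective (↔⇒↣ A↔Fin))

-- Flip algebras and the Ramsey property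

unary : Language
unary = record { Symbol = ℕ ; arity = λ _ → 1 }

module _ {K : Set} (flips : ℕ → K → Bool) where

  act : ℕ → ⊤ ⊎ K × Bool → ⊤ ⊎ K × Bool
  act i (inj₁ _)       = inj₁ tt
  act i (inj₂ (k , b)) = if flips i k then inj₂ (k , not b) else inj₁ tt

  flipAlgebra : Algebra unary
  flipAlgebra = record { Carrier = ⊤ ⊎ K × Bool ; op = λ i → act i ∘ head }

  flipAlgebra-infinite : {f : ℕ → K} → Injective _≡_ _≡_ f → Infinite (Carrier flipAlgebra)
  flipAlgebra-infinite {f} f-injective =
    infinite {f = λ n → inj₂ (f n , true)} (f-injective ∘ cong proj₁ ∘ inj₂-injective)

  -- Choosing an escaping operation for each entry reduces `b` to the constant sink sequence. Its
  -- `FR` contains nothing but the sink, so it remains to decide whether the sink lies in `X`.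
  flipAlgebra-ramsey : ExcludedMiddle 0ℓ → (∀ k → ∃[ i ] flips i k ≡ false) → IsRamsey flipAlgebra
  flipAlgebra-ramsey em escapes b X = (λ _ → sink) , reduction , homogeneous
    where
    sink : Carrier flipAlgebra
    sink = inj₁ tt

    toSink : ∀ x → ∃[ i ] sink ≡ act i x
    -- The symbol 0 is arbitrary here: every operation fixes the sink.
    toSink (inj₁ _)       = 0 , refl
    toSink (inj₂ (k , b)) = let i , eq = escapes k in
      i , cong (λ f → if f then inj₂ (k , not b) else sink) (sym eq)

    reduction : Reduction flipAlgebra (λ _ → sink) b
    reduction = termwise flipAlgebra _ (λ j → basic (proj₁ (toSink (b j)))) (λ j → proj₂ (toSink (b j)))

    FR-sink : ∀ {x} → FR flipAlgebra (λ _ → sink) x → x ≡ sink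
    FR-sink (a , r , refl) = reduction-closed flipAlgebra {P = _≡ sink}
      (λ { i (refl ∷ []) → refl }) r (λ _ → refl) 0

    homogeneous : FR flipAlgebra (λ _ → sink) ⊆ X ⊎ FR flipAlgebra (λ _ → sink) isDisjointFrom X
    homogeneous with em {X sink}
    ... | yes sink∈X = inj₁ λ x∈FR → subst X (sym (FR-sink x∈FR)) sink∈X
    ... | no  sink∉X = inj₂ λ (x∈FR , x∈X) → sink∉X (subst X (FR-sink x∈FR) x∈X)

  module _ {k : K} (trapped : ∀ i → flips i k ≡ true) where

    act-trapped : ∀ i b → act i (inj₂ (k , b)) ≡ inj₂ (k , not b)
    act-trapped i b rewrite trapped i = refl

    -- The identity yields `a 0` and operation 0 yields its flip; together they exhaust the pair.
    FR-trapped : ∀ {a b} → a 0 ≡ inj₂ (k , b) → ∀ c → FR flipAlgebra a (inj₂ (k , c))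
    FR-trapped {a} a₀≡ = pair a₀≡
      where
      kept : ∀ {b} → a 0 ≡ inj₂ (k , b) → FR flipAlgebra a (inj₂ (k , b))
      kept eq = a , termwise flipAlgebra _ (λ _ → identity) (λ _ → refl) , eq

      flipped : ∀ {b} → a 0 ≡ inj₂ (k , b) → FR flipAlgebra a (inj₂ (k , not b))
      flipped {b} eq = act 0 ∘ a , termwise flipAlgebra _ (λ _ → basic 0) (λ _ → refl) ,
                       trans (cong (act 0) eq) (act-trapped 0 b)

      pair : ∀ {b} → a 0 ≡ inj₂ (k , b) → ∀ c → FR flipAlgebra a (inj₂ (k , c))
      pair {true}  eq true  = kept eq
      pair {true}  eq false = flipped eq
      pair {false} eq true  = flipped eq
      pair {false} eq false = kept eq

    -- The trapped pair is a subalgebra, so any reduction of a sequence in it starts in it and has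
    -- both halves in its `FR`. With `X` the `true` half, the `false` half refutes containment and
    -- the `true` half refutes disjointness.
    flipAlgebra-notRamsey : ¬ IsRamsey flipAlgebra
    flipAlgebra-notRamsey ramsey
      with a , r , homogeneous ← ramsey (λ _ → inj₂ (k , true)) (_≡ inj₂ (k , true))
      with b , a₀≡ ← reduction-closed flipAlgebra {P = λ x → ∃[ b ] x ≡ inj₂ (k , b)}
                       (λ { i ((b , refl) ∷ []) → not b , act-trapped i b })
                       r (λ _ → true , refl) 0
      with homogeneous
    ... | inj₁ FR⊆X with () ← FR⊆X (FR-trapped a₀≡ false)
    ... | inj₂ FR⊥X = FR⊥X (FR-trapped a₀≡ true , refl)

-- Isomorphisms that hide the extra pair from finitely many operations

pairIso : ∀ {K M : Set} → K ↔ M → (⊤ ⊎ K × Bool) ↔ (⊤ ⊎ M × Bool)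
pairIso κ = ↔-refl ⊎-↔ (κ ×-↔ ↔-refl)

module _ {K M : Set} {flips : ℕ → K → Bool} {flips′ : ℕ → M → Bool} where

  pairIso-act : ∀ (κ : K ↔ M) i → (∀ k → flips′ i (to κ k) ≡ flips i k) →
                ∀ x → to (pairIso κ) (act flips i x) ≡ act flips′ i (to (pairIso κ) x)
  pairIso-act κ i κ-flips (inj₁ _) = refl
  pairIso-act κ i κ-flips (inj₂ (k , b)) rewrite κ-flips k with flips i k
  ... | true  = refl
  ... | false = refl

-- The index `nothing` is the extra pair; the default `true` makes every operation flip it.
addPair : (ℕ → ℕ → Bool) → ℕ → Maybe ℕ → Bool
addPair flips i = Maybe.maybe′ (flips i) true

-- Sends n to the extra point, fixes every k < n and lowers every k > n by one.
insertAt : ℕ → ℕ ↔ Maybe ℕ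
insertAt n = mk↔ₛ′ (f n) (g n) (fg n) (gf n)
  where
  f : ℕ → ℕ → Maybe ℕ
  f zero    zero    = nothing
  f zero    (suc k) = just k
  f (suc n) zero    = just zero
  f (suc n) (suc k) = Maybe.map suc (f n k)

  g : ℕ → Maybe ℕ → ℕ
  g zero    nothing        = zero
  g zero    (just k)       = suc k
  g (suc n) nothing        = suc (g n nothing)
  g (suc n) (just zero)    = zero
  g (suc n) (just (suc k)) = suc (g n (just k))

  fg : ∀ n k → f n (g n k) ≡ k
  fg zero    nothing        = refl
  fg zero    (just k)       = refl
  fg (suc n) nothing        = cong (Maybe.map suc) (fg n nothing)
  fg (suc n) (just zero)    = refl
  fg (suc n) (just (suc k)) = cong (Maybe.map suc) (fg n (just k))

  g-suc : ∀ n m → g (suc n) (Maybe.map suc m) ≡ suc (g n m)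
  g-suc n nothing  = refl
  g-suc n (just k) = refl

  gf : ∀ n k → g n (f n k) ≡ k
  gf zero    zero    = refl
  gf zero    (suc k) = refl
  gf (suc n) zero    = refl
  gf (suc n) (suc k) = trans (g-suc n (f n k)) (cong suc (gf n k))

-- Indices below `n` do not move. An index `k > n` becomes `k - 1`, which is still above `i`, and
-- `n` itself becomes the extra index; operation `i` flips all of these before and after.
insertAt-flips : ∀ {i n} → i < n → ∀ k → addPair _<ᵇ_ i (to (insertAt n) k) ≡ (i <ᵇ k)
insertAt-flips {i}     {suc n} _         zero    = refl
insertAt-flips {zero}  {suc n} _         (suc k) = flipped (to (insertAt n) k)
  where
  flipped : ∀ m → addPair _<ᵇ_ 0 (Maybe.map suc m) ≡ true
  flipped nothing  = refl
  flipped (just _) = refl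
insertAt-flips {suc i} {suc n} (s≤s i<n) (suc k) =
  trans (lower (to (insertAt n) k)) (insertAt-flips i<n k)
  where
  lower : ∀ m → addPair _<ᵇ_ (suc i) (Maybe.map suc m) ≡ addPair _<ᵇ_ i m
  lower nothing  = refl
  lower (just _) = refl

n≮ᵇn : ∀ n → (n <ᵇ n) ≡ false
n≮ᵇn zero    = refl
n≮ᵇn (suc n) = n≮ᵇn n

corollary4p5 : ExcludedMiddle 0ℓ →
    Σ[ L ∈ Language ] Σ[ 𝒜 ∈ Algebra L ] Σ[ ℬ ∈ Algebra L ]
    (Infinite (Carrier 𝒜) × Infinite (Carrier ℬ) ×
    ElementarilyEquivalent 𝒜 ℬ × IsRamsey 𝒜 × ¬ IsRamsey ℬ)
corollary4p5 em =
  unary , 𝒜 , ℬ ,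
  flipAlgebra-infinite _<ᵇ_ id ,
  flipAlgebra-infinite (addPair _<ᵇ_) just-injective ,
  eventuallyIsomorphic⇒elementarilyEquivalent 𝒜 ℬ (λ n → pairIso (insertAt n))
    -- The threshold is `suc i` because `suc i ≤ n` is by definition `i < n`.
    (λ i → suc i , λ { n i<n (x ∷ []) → pairIso-act (insertAt n) i (insertAt-flips i<n) x }) ,
  -- Operation `k` flips only indices above `k`, so it sends pair `k` to the sink.
  flipAlgebra-ramsey _<ᵇ_ em (λ k → k , n≮ᵇn k) ,
  flipAlgebra-notRamsey (addPair _<ᵇ_) {nothing} (λ _ → refl)
  where
  𝒜 ℬ : Algebra unary
  𝒜 = flipAlgebra _<ᵇ_
  ℬ = flipAlgebra (addPair _<ᵇ_)
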